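{- $t(1)=2$.
   Context: Let $\mathfrak{C}=\{0,1\}^n$ be the vertex set of the $n$-dimensional hypercube; $\oplus,\wedge$ denote bitwise XOR and AND. An outmap is any function $s:\mathfrak{C}\to\{0,1\}^n$. A clash of $s$ is a pair of distinct vertices $u,v$ with $(s(u)\oplus s(v))\wedge(u\oplus v)=0^n$. A query at $u$ to the oracle for $s$ returns $s(u)$; algorithms choose queries adaptively, and only the number of queries is counted. \textsc{Sink-or-Clash}: given oracle access to an arbitrary outmap $s$, query either a vertex $u$ with $s(u)=0^n$ or both vertices of some clash. $t(n)=\min_{\mathcal A}\max_s t(\mathcal A,s)$, where $\mathcal A$ ranges over deterministic algorithms solving \textsc{Sink-or-Clash} on all outmaps of the $n$-cube and $t(\mathcal A,s)$ is the number of queries made on $s$. -}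

module Defs where

open import Data.Bool using (Bool; false; _xor_; _∧_)
open import Data.List using (List; []; _∷_; length)
open import Data.List.Membership.Propositional using (_∈_)
open import Data.Nat using (ℕ; _≤_)
open import Data.Product using (_×_; ∃-syntax)
open import Data.Sum using (_⊎_)
open import Data.Vec using (Vec; replicate; zipWith)
open import Relation.Binary.PropositionalEquality using (_≡_; _≢_)

Bits : ℕ → Set
Bits n = Vec Bool n

infixl 6 _⊕_
infixl 7 _⋏_

_⊕_ : ∀ {n} → Bits n → Bits n → Bits n
_⊕_ = zipWith _xor_

_⋏_ : ∀ {n} → Bits n → Bits n → Bits n
_⋏_ = zipWith _∧_

𝟎 : ∀ {n} → Bits n
𝟎 {n} = replicate n false

Outmap : ℕ → Set
Outmap n = Bits n → Bits n

Clash : ∀ {n} → Outmap n → Bits n → Bits n → Set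
Clash s u v = u ≢ v × (s u ⊕ s v) ⋏ (u ⊕ v) ≡ 𝟎

-- A deterministic adaptive query algorithm, as a decision tree: either halt, or
-- query a vertex and continue according to the oracle's answer.  Computation
-- between queries is free, so nothing else about the algorithm is recorded.
data Algorithm (n : ℕ) : Set where
  halt  : Algorithm n
  query : (u : Bits n) → (answer : Bits n → Algorithm n) → Algorithm n

queried : ∀ {n} → Algorithm n → Outmap n → List (Bits n)
queried halt        s = []
queried (query u k) s = u ∷ queried (k (s u)) s

-- Repeated queries to the same vertex are counted each time.
queryCount : ∀ {n} → Algorithm n → Outmap n → ℕ
queryCount A s = length (queried A s)

FindsSink : ∀ {n} → Algorithm n → Outmap n → Set
FindsSink A s = ∃[ u ] u ∈ queried A s × s u ≡ 𝟎

FindsClash : ∀ {n} → Algorithm n → Outmap n → Set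
FindsClash A s = ∃[ u ] ∃[ v ] u ∈ queried A s × v ∈ queried A s × Clash s u v

SolvesSinkOrClash : ∀ {n} → Algorithm n → Set
SolvesSinkOrClash {n} A = (s : Outmap n) → FindsSink A s ⊎ FindsClash A s

IsMax : {X : Set} → (X → ℕ) → ℕ → Set
IsMax f m = (∃[ x ] f x ≡ m) × (∀ x → f x ≤ m)

IsLeast : (ℕ → Set) → ℕ → Set
IsLeast P m = P m × (∀ k → P k → m ≤ k)

-- `t n ≡[ m ]` says that min over solving algorithms A of max over outmaps s of
-- queryCount A s is m.  It is a relation because the minimum ranges over an
-- infinite type of algorithms; m is unique since least elements are.
t_≡[_] : ℕ → ℕ → Set
t n ≡[ m ] =
  IsLeast (λ k → ∃[ A ] SolvesSinkOrClash {n} A × IsMax (queryCount A) k) m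

{-# OPTIONS --safe #-}
module Submission where

open import Defs
open import Data.Bool using (true; false)
open import Data.List using (List; []; _∷_; length)
open import Data.List.Membership.Propositional using (_∈_)
open import Data.List.Relation.Unary.Any using (here; there)
open import Data.Nat using (_≤_; z≤n; s≤s)
open import Data.Nat.Properties using (≤-refl; ≤-trans)
open import Data.Product using (_,_)
open import Data.Sum using (inj₁; inj₂)
open import Data.Vec using ([]; _∷_)
open import Relation.Binary.PropositionalEquality using (_≡_; _≢_; refl; trans; sym)
open import Relation.Nullary using (contradiction)

-- Querying both vertices is enough: if neither is a sink, both outputs are 1,
-- which is a clash.  Conversely the constant outmap 1 has no sink, so on it a
-- solving algorithm has to exhibit a clash, which takes two distinct queries.

≢∈⇒2≤length : ∀ {X : Set} {u v : X} (xs : List X) →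
              u ∈ xs → v ∈ xs → u ≢ v → 2 ≤ length xs
≢∈⇒2≤length (_ ∷ [])    (here p) (here q) u≢v = contradiction (trans p (sym q)) u≢v
≢∈⇒2≤length (_ ∷ _ ∷ _) _        _        _   = s≤s (s≤s z≤n)

-- Ignoring the answers makes the query list the same for every outmap, so memberships and counts
-- hold by computation. Stopping early at a sink would not lower the worst case.
queryBoth : Algorithm 1
queryBoth = query (false ∷ []) λ _ → query (true ∷ []) λ _ → halt

queryBoth-solves : SolvesSinkOrClash queryBoth
queryBoth-solves s with s (false ∷ []) in eq₀ | s (true ∷ []) in eq₁
... | false ∷ [] | _          = inj₁ (_ , here refl , eq₀)
... | true ∷ []  | false ∷ [] = inj₁ (_ , there (here refl) , eq₁)
... | true ∷ []  | true ∷ []  =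
  inj₂ (_ , _ , here refl , there (here refl) , (λ ()) , clash)
  where
  clash : (s (false ∷ []) ⊕ s (true ∷ [])) ⋏ ((false ∷ []) ⊕ (true ∷ [])) ≡ 𝟎
  -- Both outputs become 1, so their XOR is 0 and its AND with the vertex difference vanishes.
  clash rewrite eq₀ | eq₁ = refl

sinkless : Outmap 1
sinkless _ = true ∷ []

2≤queryCount-sinkless : (A : Algorithm 1) → SolvesSinkOrClash A →
                        2 ≤ queryCount A sinkless
2≤queryCount-sinkless A solves with solves sinkless
... | inj₁ (_ , _ , ())
... | inj₂ (_ , _ , u∈ , v∈ , u≢v , _) = ≢∈⇒2≤length (queried A sinkless) u∈ v∈ u≢v

lemma22 : t 1 ≡[ 2 ]
lemma22 =
  -- Every outmap costs exactly two queries here, so any outmap would attain the maximum.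
  (queryBoth , queryBoth-solves , (sinkless , refl) , λ _ → ≤-refl) ,
  -- The worst case of `A` is at least its cost on the single outmap `sinkless`.
  λ _ (A , solves , _ , bounded) →
    ≤-trans (2≤queryCount-sinkless A solves) (bounded sinkless)
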